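{- Let $M$ be a connected $2$-polymatroid and let $N$ be a connected minor of $M$. If $N \neq M$, then there is an element $e$ of $E(M) - E(N)$ such that at least one of $M \backslash e$ and $M / e$ is connected and has $N$ as a minor.
   Context: For a positive integer $k$, a $k$-polymatroid $M$ is a pair $(E,r)$ consisting of a finite set $E=E(M)$ (the ground set) and a function $r=r_M$ (the rank function) from the power set of $E$ into the integers such that: (i) $r(\emptyset)=0$; (ii) $r(X)\le r(Y)$ whenever $X\subseteq Y\subseteq E$; (iii) $r(X)+r(Y)\ge r(X\cup Y)+r(X\cap Y)$ for all $X,Y\subseteq E$; (iv) $r(\{e\})\le k$ for all $e\in E$. A $2$-polymatroid is the case $k=2$. For $T\subseteq E$, the deletion $M\backslash T$ and the contraction $M/T$ are the polymatroids on ground set $E-T$ with rank functions $r_{M\backslash T}(X)=r(X)$ and $r_{M/T}(X)=r(X\cup T)-r(T)$ for all $X\subseteq E-T$. Write $M\backslash e$ and $M/e$ for $M\backslash\{e\}$ and $M/\{e\}$. A minor of $M$ is any polymatroid obtained from $M$ by a (possibly empty) sequence of deletions and contractions; thus the ground set of a minor is a subset of $E(M)$, and "having $N$ as a minor" means equality with such a polymatroid (not merely isomorphism). A polymatroid $(E,r)$ is connected if there is no non-empty proper subset $X$ of $E$ such that $r(X)+r(E-X)=r(E)$. -}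

module Defs where

open import Data.Nat.Base using (ℕ)
open import Data.Integer.Base using (ℤ; +_; 0ℤ; _+_; _-_; -_; _≤_; _≥_)
open import Data.Integer.Properties
open import Data.Integer.Tactic.RingSolver using (solve-∀)
open import Data.Fin.Base using (Fin)
open import Data.Fin.Subset
  using (Subset; _∈_; _⊆_; _⊂_; _∪_; _∩_; _─_; ⁅_⁆; ⊥; Nonempty)
open import Data.Fin.Subset.Properties
open import Data.Product.Base using (∃; _×_)
open import Data.Sum.Base using ([_,_]′)
open import Function.Base using (_∘_)
open import Relation.Nullary using (¬_)
open import Relation.Binary.PropositionalEquality
  using (_≡_; sym; trans; cong; cong₂; subst)

-- The ground set E is an arbitrary subset of Fin n, so that the ground sets
-- of a polymatroid and of its minors live in the same type.  The rank
-- function is total on Subset n, but only its values at subsets of E carry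
-- meaning: the axioms constrain only these, and _≈_ below compares only these.

record Polymatroid (k n : ℕ) : Set where
  field
    E         : Subset n
    r         : Subset n → ℤ
    r-⊥       : r ⊥ ≡ 0ℤ
    r-mono    : ∀ {X Y} → X ⊆ Y → Y ⊆ E → r X ≤ r Y
    r-submod  : ∀ {X Y} → X ⊆ E → Y ⊆ E → r X + r Y ≥ r (X ∪ Y) + r (X ∩ Y)
    r-bounded : ∀ {e} → e ∈ E → r ⁅ e ⁆ ≤ + k

open Polymatroid public

infix 4 _≈_

_≈_ : ∀ {k n} → Polymatroid k n → Polymatroid k n → Set
M ≈ N = E M ≡ E N × (∀ {X} → X ⊆ E M → r M X ≡ r N X)

Connected : ∀ {k n} → Polymatroid k n → Set
Connected M =
  ¬ (∃ λ X → Nonempty X × X ⊂ E M × r M X + r M (E M ─ X) ≡ r M (E M))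

⁅⁆-⊆ : ∀ {n} {e : Fin n} {p : Subset n} → e ∈ p → ⁅ e ⁆ ⊆ p
⁅⁆-⊆ {e = e} {p} e∈p x∈ = subst (_∈ p) (sym (x∈⁅y⁆⇒x≡y e x∈)) e∈p

∪-⊆ : ∀ {n} {p q s : Subset n} → p ⊆ s → q ⊆ s → p ∪ q ⊆ s
∪-⊆ {p = p} {q} p⊆s q⊆s = [ p⊆s , q⊆s ]′ ∘ x∈p∪q⁻ p q

delete : ∀ {k n} (M : Polymatroid k n) (T : Subset n) → T ⊆ E M → Polymatroid k n
delete M T _ = record
  { E         = E M ─ T
  ; r         = r M
  ; r-⊥       = r-⊥ M
  ; r-mono    = λ X⊆Y Y⊆ → r-mono M X⊆Y (E─T⊆E ∘ Y⊆)
  ; r-submod  = λ X⊆ Y⊆ → r-submod M (E─T⊆E ∘ X⊆) (E─T⊆E ∘ Y⊆)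
  ; r-bounded = λ e∈ → r-bounded M (E─T⊆E e∈)
  }
  where
  E─T⊆E : E M ─ T ⊆ E M
  E─T⊆E = p─q⊆p (E M) T

contract : ∀ {k n} (M : Polymatroid k n) (T : Subset n) → T ⊆ E M → Polymatroid k n
contract {k} {n} M T T⊆E = record
  { E         = E M ─ T
  ; r         = r/T
  ; r-⊥       = trans (cong (λ X → r M X - r M T) (∪-identityˡ T)) (+-inverseʳ (r M T))
  ; r-mono    = λ {X} {Y} X⊆Y Y⊆ →
                  +-monoˡ-≤ (- r M T) (r-mono M (∪-mono X⊆Y) (∪T⊆E Y⊆))
  ; r-submod  = submod
  ; r-bounded = bounded
  }
  where
  r/T : Subset n → ℤ
  r/T X = r M (X ∪ T) - r M T

  ∪T⊆E : ∀ {X} → X ⊆ E M ─ T → X ∪ T ⊆ E M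
  ∪T⊆E X⊆ = ∪-⊆ (p─q⊆p (E M) T ∘ X⊆) T⊆E

  ∪-mono : ∀ {X Y} → X ⊆ Y → X ∪ T ⊆ Y ∪ T
  ∪-mono {X} {Y} X⊆Y = ∪-⊆ (p⊆p∪q T ∘ X⊆Y) (q⊆p∪q Y T)

  ∪-collect : ∀ X Y → (X ∪ T) ∪ (Y ∪ T) ≡ (X ∪ Y) ∪ T
  ∪-collect X Y = ⊆-antisym
    (∪-⊆ (∪-mono (p⊆p∪q Y)) (∪-mono (q⊆p∪q X Y)))
    (∪-⊆ (∪-⊆ (p⊆p∪q (Y ∪ T) ∘ p⊆p∪q T) (q⊆p∪q (X ∪ T) (Y ∪ T) ∘ p⊆p∪q T))
         (p⊆p∪q (Y ∪ T) ∘ q⊆p∪q X T))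

  shift : ∀ a b c → (a - c) + (b - c) ≡ (a + b) + (- c + - c)
  shift = solve-∀

  submod : ∀ {X Y} → X ⊆ E M ─ T → Y ⊆ E M ─ T →
           r/T X + r/T Y ≥ r/T (X ∪ Y) + r/T (X ∩ Y)
  submod {X} {Y} X⊆ Y⊆ = begin
    r/T (X ∪ Y) + r/T (X ∩ Y)
      ≡⟨ shift (r M ((X ∪ Y) ∪ T)) (r M ((X ∩ Y) ∪ T)) t ⟩
    (r M ((X ∪ Y) ∪ T) + r M ((X ∩ Y) ∪ T)) + (- t + - t)
      ≡⟨ cong (_+ (- t + - t)) (cong₂ (λ U V → r M U + r M V)
           (sym (∪-collect X Y)) (∪-distribʳ-∩ T X Y)) ⟩
    (r M ((X ∪ T) ∪ (Y ∪ T)) + r M ((X ∪ T) ∩ (Y ∪ T))) + (- t + - t)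
      ≤⟨ +-monoˡ-≤ (- t + - t) (r-submod M (∪T⊆E X⊆) (∪T⊆E Y⊆)) ⟩
    (r M (X ∪ T) + r M (Y ∪ T)) + (- t + - t)
      ≡⟨ sym (shift (r M (X ∪ T)) (r M (Y ∪ T)) t) ⟩
    r/T X + r/T Y ∎
    where
    open ≤-Reasoning
    t = r M T

  bounded : ∀ {e} → e ∈ E M ─ T → r/T ⁅ e ⁆ ≤ + k
  bounded {e} e∈ = begin
    r M (⁅ e ⁆ ∪ T) - t
      ≡⟨ cong (_- t) (sym (+-identityʳ (r M (⁅ e ⁆ ∪ T)))) ⟩
    r M (⁅ e ⁆ ∪ T) + 0ℤ - t
      ≤⟨ +-monoˡ-≤ (- t) (+-monoʳ-≤ (r M (⁅ e ⁆ ∪ T)) 0≤r) ⟩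
    r M (⁅ e ⁆ ∪ T) + r M (⁅ e ⁆ ∩ T) - t
      ≤⟨ +-monoˡ-≤ (- t) (r-submod M (⁅⁆-⊆ e∈E) T⊆E) ⟩
    r M ⁅ e ⁆ + t - t
      ≡⟨ cancel (r M ⁅ e ⁆) t ⟩
    r M ⁅ e ⁆
      ≤⟨ r-bounded M e∈E ⟩
    + k ∎
    where
    open ≤-Reasoning
    t = r M T

    cancel : ∀ a b → a + b - b ≡ a
    cancel = solve-∀

    e∈E : e ∈ E M
    e∈E = p─q⊆p (E M) T e∈

    0≤r : 0ℤ ≤ r M (⁅ e ⁆ ∩ T)
    0≤r = subst (_≤ r M (⁅ e ⁆ ∩ T)) (r-⊥ M)
            (r-mono M (⊆-min _) (T⊆E ∘ p∩q⊆q ⁅ e ⁆ T))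

delete₁ : ∀ {k n} (M : Polymatroid k n) (e : Fin n) → e ∈ E M → Polymatroid k n
delete₁ M e e∈E = delete M ⁅ e ⁆ (⁅⁆-⊆ e∈E)

contract₁ : ∀ {k n} (M : Polymatroid k n) (e : Fin n) → e ∈ E M → Polymatroid k n
contract₁ M e e∈E = contract M ⁅ e ⁆ (⁅⁆-⊆ e∈E)

infix 4 _IsMinorOf_

data _IsMinorOf_ {k n : ℕ} (N : Polymatroid k n) : Polymatroid k n → Set where
  equal       : ∀ {M} → N ≈ M → N IsMinorOf M
  by-delete   : ∀ {M} T (T⊆E : T ⊆ E M) → N IsMinorOf delete M T T⊆E → N IsMinorOf M
  by-contract : ∀ {M} T (T⊆E : T ⊆ E M) → N IsMinorOf contract M T T⊆E → N IsMinorOf M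

{-# OPTIONS --safe #-}

-- Remove some e keeping N as a minor, say by deletion (contraction is dual).  If
-- M \ e is disconnected, it has a separation (X, Y) with E(N) ⊆ X, and then for
-- each y ∈ Y the minor N can be rerouted so that y is contracted.  If M / y is
-- disconnected as well, with separation (R, S) and e ∈ S, then X ∩ R would be
-- separated from its complement in M, so it is empty and R ⊆ Y − y.  Now (S, R)
-- replaces (X, Y), deletion and contraction alternate, and the side away from N
-- shrinks until a removal is connected.
module Submission where

open import Defs
open import Data.Nat.Base using (ℕ)
open import Data.Fin.Base using (Fin)
open import Data.Fin.Subset using (_∈_; _∉_)
open import Data.Product.Base using (Σ; ∃; _×_)
open import Data.Sum.Base using (_⊎_)
open import Relation.Nullary using (¬_)

open import Data.Empty using (⊥-elim)
open import Data.Fin.Properties using (any?) renaming (_≟_ to _≟ᶠ_)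
open import Data.Fin.Subset
  using (Subset; inside; outside; _⊆_; _⊂_; _∪_; _∩_; _─_; ⁅_⁆; ⊥; Nonempty; ∣_∣)
open import Data.Fin.Subset.Properties
open import Data.Integer.Base using (ℤ; 0ℤ; _+_; _-_; _≤_)
open import Data.Integer.Properties
  using (≤-antisym; ≤-reflexive; +-mono-≤; +-monoˡ-≤; +-monoʳ-≤; +-identityʳ;
         +-comm; i≤j⇒i-j≤0; i-j≤0⇒i≤j; i≡j⇒i-j≡0; i-j≡0⇒i≡j; module ≤-Reasoning)
  renaming (_≟_ to _≟ᶻ_)
open import Data.Integer.Tactic.RingSolver using (solve-∀)
open import Data.Nat.Base using (_<_)
open import Data.Nat.Induction using (<-wellFounded)
open import Data.Product.Base using (∃₂; _,_; proj₁; proj₂)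
open import Data.Sum.Base using (inj₁; inj₂; [_,_]′) renaming (swap to swap⊎)
open import Data.Vec.Base using (_∷_; here; there)
open import Function.Base using (_∘_; id)
open import Induction.WellFounded using (Acc; acc)
open import Relation.Binary.PropositionalEquality
  using (_≡_; refl; sym; trans; cong; cong₂; subst; subst₂)
open import Relation.Nullary using (yes; no; ¬?)
open import Relation.Nullary.Decidable using (_×-dec_; decidable-stable)

private
  variable
    k n : ℕ

-- Integer arithmetic and membership in subsets

-- Reduces each rank computation below to a sum of known inequalities and one ring identity, which
-- `solve-∀` proves.
≤-by : ∀ {i j i′ j′} → i ≤ j → i - j ≡ i′ - j′ → i′ ≤ j′
≤-by i≤j eq = i-j≤0⇒i≤j (subst (_≤ 0ℤ) eq (i≤j⇒i-j≤0 i≤j))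

≡-by : ∀ {i j i′ j′} → i ≡ j → i - j ≡ i′ - j′ → i′ ≡ j′
≡-by {i} {j} {i′} {j′} i≡j eq =
  i-j≡0⇒i≡j i′ j′ (trans (sym eq) (i≡j⇒i-j≡0 i≡j))

∈-∪ˡ : ∀ {p q : Subset n} {x} → x ∈ p → x ∈ p ∪ q
∈-∪ˡ {q = q} = p⊆p∪q q

∈-∪ʳ : ∀ {p q : Subset n} {x} → x ∈ q → x ∈ p ∪ q
∈-∪ʳ {p = p} {q} = q⊆p∪q p q

∉-─ : ∀ (p q : Subset n) {x} → x ∈ p ─ q → x ∉ q
∉-─ (_ ∷ p) (inside  ∷ q) (there x∈) (there x∈q) = ∉-─ p q x∈ x∈q
∉-─ (_ ∷ p) (outside ∷ q) (there x∈) (there x∈q) = ∉-─ p q x∈ x∈q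

-- Submodularity and modular pairs

module _ (M : Polymatroid k n) where

  open Polymatroid M using () renaming (E to G; r to ρ)

  -- Monotonicity absorbs the difference between `P`, `I` and the actual union and intersection, so
  -- later uses need inclusions rather than set equalities.
  submodular : ∀ {U V P I} → U ⊆ G → V ⊆ G → P ⊆ U ∪ V → I ⊆ U → I ⊆ V →
               ρ P + ρ I ≤ ρ U + ρ V
  submodular {U} {V} {P} {I} U⊆ V⊆ P⊆ I⊆U I⊆V = begin
    ρ P + ρ I
      ≤⟨ +-mono-≤ (r-mono M P⊆ (∪-⊆ U⊆ V⊆))
           (r-mono M (λ x∈ → x∈p∩q⁺ (I⊆U x∈ , I⊆V x∈)) (U⊆ ∘ p∩q⊆p U V)) ⟩
    ρ (U ∪ V) + ρ (U ∩ V)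
      ≤⟨ r-submod M U⊆ V⊆ ⟩
    ρ U + ρ V ∎
    where open ≤-Reasoning

  -- `Connected` forbids an equality, yet ≤ is already contradictory: the reverse inequality is
  -- submodularity with `r-⊥`. Keeping `B` as a set of its own avoids computing complements.
  connected⇒inseparable : Connected M → ∀ {A B} → A ⊆ G → B ⊆ G → G ⊆ A ∪ B →
    (∀ {x} → x ∈ A → x ∉ B) → Nonempty A → Nonempty B →
    ¬ (ρ A + ρ B ≤ ρ G)
  connected⇒inseparable conn {A} {B} A⊆ B⊆ G⊆ A#B A≠∅ (b , b∈B) sep =
    conn (A , A≠∅ , (A⊆ , b , B⊆ b∈B , λ b∈A → A#B b∈A b∈B) , ≤-antisym upper lower)
    where
    G─A⊆B : G ─ A ⊆ B
    G─A⊆B {x} x∈ = [ (λ x∈A → ⊥-elim (∉-─ G A x∈ x∈A)) , id ]′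
      (x∈p∪q⁻ A B (G⊆ (p─q⊆p G A x∈)))

    upper : ρ A + ρ (G ─ A) ≤ ρ G
    upper = begin
      ρ A + ρ (G ─ A) ≤⟨ +-monoʳ-≤ (ρ A) (r-mono M G─A⊆B B⊆) ⟩
      ρ A + ρ B       ≤⟨ sep ⟩
      ρ G             ∎
      where open ≤-Reasoning

    G⊆A∪G─A : G ⊆ A ∪ (G ─ A)
    G⊆A∪G─A {x} x∈ with x ∈? A
    ... | yes x∈A = ∈-∪ˡ x∈A
    ... | no  x∉A = ∈-∪ʳ {p = A} (x∈p∧x∉q⇒x∈p─q x∈ x∉A)

    lower : ρ G ≤ ρ A + ρ (G ─ A)
    lower = begin
      ρ G             ≡⟨ +-identityʳ (ρ G) ⟨
      ρ G + 0ℤ        ≡⟨ cong (ρ G +_) (r-⊥ M) ⟨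
      ρ G + ρ ⊥       ≤⟨ submodular A⊆ (p─q⊆p G A) G⊆A∪G─A (⊆-min _) (⊆-min _) ⟩
      ρ A + ρ (G ─ A) ∎
      where open ≤-Reasoning

  -- The defect r(U) + r(V) - r(U ∪ V) cannot grow when a side shrinks. Shrink `U` first and then
  -- `V`, each time by one use of submodularity.
  modular-restrict : ∀ {U V} c → U ⊆ G → V ⊆ G → ρ U + ρ V ≤ ρ (U ∪ V) + c →
    ∀ {U′ V′} → U′ ⊆ U → V′ ⊆ V → ρ U′ + ρ V′ ≤ ρ (U′ ∪ V′) + c
  modular-restrict {U} {V} c U⊆ V⊆ mod {U′} {V′} U′⊆ V′⊆ =
    ≤-by (+-mono-≤ mod (+-mono-≤ shrinkU shrinkV))
      (lin (ρ U) (ρ V) (ρ (U ∪ V)) (ρ U′) (ρ V′) (ρ (U′ ∪ V)) (ρ (U′ ∪ V′)) c)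
    where
    U′∪V⊆G : U′ ∪ V ⊆ G
    U′∪V⊆G = ∪-⊆ (U⊆ ∘ U′⊆) V⊆

    shrinkU : ρ (U ∪ V) + ρ U′ ≤ ρ U + ρ (U′ ∪ V)
    shrinkU = submodular U⊆ U′∪V⊆G
      (∪-⊆ ∈-∪ˡ (∈-∪ʳ {p = U} ∘ ∈-∪ʳ {p = U′})) U′⊆ ∈-∪ˡ

    shrinkV : ρ (U′ ∪ V) + ρ V′ ≤ ρ V + ρ (U′ ∪ V′)
    shrinkV = submodular V⊆ (∪-⊆ (U⊆ ∘ U′⊆) (V⊆ ∘ V′⊆))
      (∪-⊆ (∈-∪ʳ {p = V} ∘ ∈-∪ˡ) ∈-∪ˡ) V′⊆ (∈-∪ʳ {p = U′})

    lin : ∀ u v uv u′ v′ u′v u′v′ c →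
      ((u + v) + ((uv + u′) + (u′v + v′))) - ((uv + c) + ((u + u′v) + (v + u′v′)))
      ≡ (u′ + v′) - (u′v′ + c)
    lin = solve-∀

-- Separations of single-element deletions and contractions

-- A separation of M \ e when T = ∅, and of M / e when T = {e}.
record Separation (M : Polymatroid k n) (T : Subset n) (e : Fin n) (X Y : Subset n) : Set where
  field
    e∈E      : e ∈ E M
    T⊆e      : T ⊆ ⁅ e ⁆
    X⊆E      : X ⊆ E M
    Y⊆E      : Y ⊆ E M
    e∉X      : e ∉ X
    e∉Y      : e ∉ Y
    X≠∅      : Nonempty X
    Y≠∅      : Nonempty Y
    disjoint : ∀ {x} → x ∈ X → x ∉ Y
    cover    : ∀ {x} → x ∈ E M → (x ∈ X ⊎ x ∈ Y) ⊎ x ≡ e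
    modular  : r M (X ∪ T) + r M (Y ∪ T) ≤ r M ((X ∪ T) ∪ (Y ∪ T)) + r M T

  T⊆E : T ⊆ E M
  T⊆E = ⁅⁆-⊆ e∈E ∘ T⊆e

  X∪T⊆E : X ∪ T ⊆ E M
  X∪T⊆E = ∪-⊆ X⊆E T⊆E

  Y∪T⊆E : Y ∪ T ⊆ E M
  Y∪T⊆E = ∪-⊆ Y⊆E T⊆E

  modular-≤ : ∀ {U V} → U ⊆ X ∪ T → V ⊆ Y ∪ T →
              r M U + r M V ≤ r M (U ∪ V) + r M T
  modular-≤ = modular-restrict M (r M T) X∪T⊆E Y∪T⊆E modular

  -- `modular-≤` is one direction; the other is submodularity, because `T` lies in both `U` and `V`.
  modular-≡ : ∀ {U V P} → T ⊆ U → U ⊆ X ∪ T → T ⊆ V → V ⊆ Y ∪ T → U ∪ V ≡ P →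
              r M U + r M V ≡ r M P + r M T
  modular-≡ T⊆U U⊆ T⊆V V⊆ refl = ≤-antisym (modular-≤ U⊆ V⊆)
    (submodular M (X∪T⊆E ∘ U⊆) (Y∪T⊆E ∘ V⊆) id T⊆U T⊆V)

swap : ∀ {M : Polymatroid k n} {T e X Y} → Separation M T e X Y → Separation M T e Y X
swap {M = M} {T} {e} {X} {Y} s = record
  { e∈E = e∈E ; T⊆e = T⊆e ; X⊆E = Y⊆E ; Y⊆E = X⊆E ; e∉X = e∉Y ; e∉Y = e∉X
  ; X≠∅ = Y≠∅ ; Y≠∅ = X≠∅
  ; disjoint = λ x∈Y x∈X → disjoint x∈X x∈Y
  ; cover = λ x∈ → [ inj₁ ∘ swap⊎ , inj₂ ]′ (cover x∈)
  ; modular = subst₂ _≤_ (+-comm (r M (X ∪ T)) (r M (Y ∪ T)))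
      (cong (λ U → r M U + r M T) (∪-comm (X ∪ T) (Y ∪ T))) modular
  }
  where open Separation s

towards : ∀ {M : Polymatroid k n} {T e f} → f ∈ E M → ¬ (f ≡ e) →
  ∃₂ (Separation M T e) → ∃₂ λ X Y → Separation M T e X Y × f ∈ Y
towards f∈ f≢e (X , Y , s) with Separation.cover s f∈
... | inj₁ (inj₁ f∈X) = Y , X , swap s , f∈X
... | inj₁ (inj₂ f∈Y) = X , Y , s , f∈Y
... | inj₂ f≡e = ⊥-elim (f≢e f≡e)

-- Treats deletion and contraction together, through the common rank formula in `T`. The disjunction
-- is constructive because the finitely many candidate sets can be searched.
connected⊎separation : ∀ (M M′ : Polymatroid k n) {T e} → e ∈ E M → T ⊆ ⁅ e ⁆ →
  E M′ ≡ E M ─ ⁅ e ⁆ → (∀ X → r M′ X ≡ r M (X ∪ T) - r M T) →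
  Connected M′ ⊎ ∃₂ (Separation M T e)
connected⊎separation M M′ {T} {e} e∈E T⊆e E≡ r≡
  with anySubset? (λ X → nonempty? X ×-dec (X ⊂? E M′) ×-dec
                         (r M′ X + r M′ (E M′ ─ X) ≟ᶻ r M′ (E M′)))
... | no ¬sep = inj₁ ¬sep
... | yes (X , X≠∅ , (X⊆ , y , y∈ , y∉X) , sep) = inj₂ (X , Y , record
  { e∈E = e∈E ; T⊆e = T⊆e
  ; X⊆E = E′⊆E ∘ X⊆ ; Y⊆E = E′⊆E ∘ Y⊆
  ; e∉X = e∉E′ ∘ X⊆ ; e∉Y = e∉E′ ∘ Y⊆
  ; X≠∅ = X≠∅ ; Y≠∅ = y , x∈p∧x∉q⇒x∈p─q y∈ y∉X
  ; disjoint = λ x∈X x∈Y → ∉-─ (E M′) X x∈Y x∈X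
  ; cover = cover
  ; modular = ≤-by (+-mono-≤ (≤-reflexive sep′) mono)
      (lin (r M (X ∪ T)) (r M (Y ∪ T)) (r M T) (r M (E M′ ∪ T)) (r M ((X ∪ T) ∪ (Y ∪ T))))
  })
  where
  Y = E M′ ─ X

  Y⊆ : Y ⊆ E M′
  Y⊆ = p─q⊆p (E M′) X

  E′⊆E : E M′ ⊆ E M
  E′⊆E = p─q⊆p (E M) ⁅ e ⁆ ∘ subst (_ ∈_) E≡

  e∉E′ : e ∉ E M′
  e∉E′ e∈ = ∉-─ (E M) ⁅ e ⁆ (subst (e ∈_) E≡ e∈) (x∈⁅x⁆ e)

  split : ∀ {x} → x ∈ E M′ → x ∈ X ⊎ x ∈ Y
  split {x} x∈ with x ∈? X
  ... | yes x∈X = inj₁ x∈X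
  ... | no  x∉X = inj₂ (x∈p∧x∉q⇒x∈p─q x∈ x∉X)

  cover : ∀ {x} → x ∈ E M → (x ∈ X ⊎ x ∈ Y) ⊎ x ≡ e
  cover {x} x∈ with x ≟ᶠ e
  ... | yes x≡e = inj₂ x≡e
  ... | no  x≢e = inj₁ (split (subst (x ∈_) (sym E≡)
                    (x∈p∧x∉q⇒x∈p─q x∈ (x≢e ∘ x∈⁅y⁆⇒x≡y e))))

  sep′ : (r M (X ∪ T) - r M T) + (r M (Y ∪ T) - r M T) ≡ r M (E M′ ∪ T) - r M T
  sep′ = trans (cong₂ _+_ (sym (r≡ X)) (sym (r≡ Y))) (trans sep (r≡ (E M′)))

  T⊆E : T ⊆ E M
  T⊆E = ⁅⁆-⊆ e∈E ∘ T⊆e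

  mono : r M (E M′ ∪ T) ≤ r M ((X ∪ T) ∪ (Y ∪ T))
  mono = r-mono M
    (∪-⊆ ([ ∈-∪ˡ ∘ ∈-∪ˡ , ∈-∪ʳ {p = X ∪ T} ∘ ∈-∪ˡ ]′ ∘ split)
         (∈-∪ˡ ∘ ∈-∪ʳ {p = X}))
    (∪-⊆ (∪-⊆ (E′⊆E ∘ X⊆) T⊆E) (∪-⊆ (E′⊆E ∘ Y⊆) T⊆E))

  lin : ∀ x y t g u → ((x - t) + (y - t) + g) - ((g - t) + u) ≡ (x + y) - (u + t)
  lin = solve-∀

module _ (M : Polymatroid k n) {e : Fin n} (e∈E : e ∈ E M) where

  delete-connected⊎separation : Connected (delete₁ M e e∈E) ⊎ ∃₂ (Separation M ⊥ e)
  delete-connected⊎separation =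
    connected⊎separation M (delete₁ M e e∈E) e∈E (⊆-min _) refl λ X →
      sym (trans (cong₂ _-_ (cong (r M) (∪-identityʳ X)) (r-⊥ M)) (+-identityʳ (r M X)))

  contract-connected⊎separation : Connected (contract₁ M e e∈E) ⊎ ∃₂ (Separation M ⁅ e ⁆ e)
  contract-connected⊎separation =
    connected⊎separation M (contract₁ M e e∈E) e∈E id refl λ _ → refl

-- Write A = X ∩ R, B = (Y ∩ R) ∪ y.  The separation of M \ e gives
-- r(A) + r(B) = r(R ∪ y), and then that of M / y together with submodularity
-- of B and S ∪ y shows that A is separated from E − A in M.
separations-cross : ∀ {M : Polymatroid k n} {e y X Y R S} → Connected M →
  Separation M ⊥ e X Y → Separation M ⁅ y ⁆ y R S → y ∈ Y → e ∈ S →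
  ∀ {a} → a ∈ X → a ∉ R
separations-cross {M = M} {e} {y} {X} {Y} {R} {S} conn XY RS y∈Y e∈S {a} a∈X a∈R =
  connected⇒inseparable M conn A⊆E (∪-⊆ B⊆E C⊆E) E⊆ A#B∪C (a , x∈p∩q⁺ (a∈X , a∈R))
    (y , ∈-∪ˡ y∈B)
    (≤-by (+-mono-≤ split-R (+-mono-≤ joined RS.modular-E))
      (lin (r M A) (r M B) (r M (R ∪ ⁅ y ⁆)) (r M (B ∪ C)) (r M C) (r M ⁅ y ⁆) (r M (E M))))
  where
  module XY = Separation XY
  module RS where
    open Separation RS public

    modular-E : r M (R ∪ ⁅ y ⁆) + r M (S ∪ ⁅ y ⁆) ≤ r M (E M) + r M ⁅ y ⁆
    modular-E = begin
      r M (R ∪ ⁅ y ⁆) + r M (S ∪ ⁅ y ⁆)                ≤⟨ modular ⟩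
      r M ((R ∪ ⁅ y ⁆) ∪ (S ∪ ⁅ y ⁆)) + r M ⁅ y ⁆
        ≤⟨ +-monoˡ-≤ (r M ⁅ y ⁆) (r-mono M (∪-⊆ X∪T⊆E Y∪T⊆E) id) ⟩
      r M (E M) + r M ⁅ y ⁆ ∎
      where open ≤-Reasoning

  A B C : Subset _
  A = X ∩ R
  B = (Y ∩ R) ∪ ⁅ y ⁆
  C = S ∪ ⁅ y ⁆

  A⊆E : A ⊆ E M
  A⊆E = XY.X⊆E ∘ p∩q⊆p X R

  B⊆E : B ⊆ E M
  B⊆E = ∪-⊆ (XY.Y⊆E ∘ p∩q⊆p Y R) RS.T⊆E

  C⊆E : C ⊆ E M
  C⊆E = RS.Y∪T⊆E

  y∈B : y ∈ B
  y∈B = ∈-∪ʳ {p = Y ∩ R} (x∈⁅x⁆ y)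

  B⊆Y : B ⊆ Y
  B⊆Y = ∪-⊆ (p∩q⊆p Y R) (⁅⁆-⊆ y∈Y)

  split-R : r M A + r M B ≤ r M (R ∪ ⁅ y ⁆)
  split-R = begin
    r M A + r M B        ≤⟨ XY.modular-≤ (∈-∪ˡ ∘ p∩q⊆p X R) (∈-∪ˡ ∘ B⊆Y) ⟩
    r M (A ∪ B) + r M ⊥  ≡⟨ trans (cong (r M (A ∪ B) +_) (r-⊥ M)) (+-identityʳ _) ⟩
    r M (A ∪ B)
      ≤⟨ r-mono M (∪-⊆ (∈-∪ˡ ∘ p∩q⊆q X R) (∪-⊆ (∈-∪ˡ ∘ p∩q⊆q Y R) (∈-∪ʳ {p = R}))) RS.X∪T⊆E ⟩
    r M (R ∪ ⁅ y ⁆) ∎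
    where open ≤-Reasoning

  joined : r M (B ∪ C) + r M ⁅ y ⁆ ≤ r M B + r M C
  joined = submodular M B⊆E C⊆E id (∈-∪ʳ {p = Y ∩ R}) (∈-∪ʳ {p = S})

  A#B∪C : ∀ {x} → x ∈ A → x ∉ B ∪ C
  A#B∪C x∈A x∈ with x∈p∩q⁻ X R x∈A | x∈p∪q⁻ B C x∈
  ... | x∈X , x∈R | inj₁ x∈B = XY.disjoint x∈X (B⊆Y x∈B)
  ... | x∈X , x∈R | inj₂ x∈C with x∈p∪q⁻ S ⁅ y ⁆ x∈C
  ... | inj₁ x∈S = RS.disjoint x∈R x∈S
  ... | inj₂ x∈y = XY.disjoint x∈X (⁅⁆-⊆ y∈Y x∈y)

  E⊆ : E M ⊆ A ∪ (B ∪ C)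
  E⊆ x∈ with RS.cover x∈
  ... | inj₂ refl = ∈-∪ʳ {p = A} (∈-∪ˡ y∈B)
  ... | inj₁ (inj₂ x∈S) = ∈-∪ʳ {p = A} (∈-∪ʳ {p = B} (∈-∪ˡ x∈S))
  ... | inj₁ (inj₁ x∈R) with XY.cover x∈
  ... | inj₁ (inj₁ x∈X) = ∈-∪ˡ (x∈p∩q⁺ (x∈X , x∈R))
  ... | inj₁ (inj₂ x∈Y) = ∈-∪ʳ {p = A} (∈-∪ˡ (∈-∪ˡ (x∈p∩q⁺ (x∈Y , x∈R))))
  -- The one element that `X` and `Y` miss is `e`; this is where `e∈S` enters.
  ... | inj₂ refl = ∈-∪ʳ {p = A} (∈-∪ʳ {p = B} (∈-∪ˡ e∈S))

  lin : ∀ a b d bc c t g →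
    ((a + b) + ((bc + t) + (d + c))) - (d + ((b + c) + (g + t))) ≡ (a + bc) - g
  lin = solve-∀

-- Minors described by their contracted set

-- The minors of M on the ground set E N are M / C \ (E M − C − E N), one for each C.
record _IsMinorOf_Via_ (N M : Polymatroid k n) (C : Subset n) : Set where
  field
    EN⊆EM    : E N ⊆ E M
    C⊆E      : C ⊆ E M
    disjoint : ∀ {x} → x ∈ E N → x ∉ C
    rank     : ∀ {Z} → Z ⊆ E N → r N Z + r M C ≡ r M (Z ∪ C)

-- Induction along the sequence of operations: a deletion leaves `C` alone, a contraction of `T`
-- adds `T` to it, and the ranks telescope.
minor⇒via : ∀ {M N : Polymatroid k n} → N IsMinorOf M → ∃ (N IsMinorOf M Via_)
minor⇒via {N = N} (equal {M} (E≡ , r≡)) = ⊥ , record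
  { EN⊆EM = subst (_ ∈_) E≡
  ; C⊆E = ⊆-min _
  ; disjoint = λ _ → ∉⊥
  ; rank = λ {Z} Z⊆ → trans (cong₂ _+_ (r≡ Z⊆) (r-⊥ M))
      (trans (+-identityʳ (r M Z)) (cong (r M) (sym (∪-identityʳ Z))))
  }
minor⇒via (by-delete {M} T T⊆E N≤) with minor⇒via N≤
... | C , via = C , record
  { EN⊆EM = p─q⊆p (E M) T ∘ EN⊆EM
  ; C⊆E = p─q⊆p (E M) T ∘ C⊆E
  ; disjoint = disjoint
  ; rank = rank
  }
  where open _IsMinorOf_Via_ via
minor⇒via {N = N} (by-contract {M} T T⊆E N≤) with minor⇒via N≤
... | C , via = C ∪ T , record
  { EN⊆EM = p─q⊆p (E M) T ∘ EN⊆EM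
  ; C⊆E = ∪-⊆ (p─q⊆p (E M) T ∘ C⊆E) T⊆E
  ; disjoint = λ x∈ → [ disjoint x∈ , ∉-─ (E M) T (EN⊆EM x∈) ]′ ∘ x∈p∪q⁻ C T
  ; rank = λ {Z} Z⊆ → trans
      (≡-by (rank Z⊆) (lin (r N Z) (r M (C ∪ T)) (r M T) (r M ((Z ∪ C) ∪ T))))
      (cong (r M) (∪-assoc Z C T))
  }
  where
  open _IsMinorOf_Via_ via

  lin : ∀ a b t c → (a + (b - t)) - (c - t) ≡ (a + b) - c
  lin = solve-∀

via⇒minor : ∀ {M N : Polymatroid k n} {C} → N IsMinorOf M Via C → N IsMinorOf M
via⇒minor {M = M} {N} {C} via =
  by-contract C C⊆E (by-delete D D⊆ (equal (⊆-antisym EN⊆ ⊆EN , λ {X} X⊆ →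
    ≡-by (rank X⊆) (lin (r N X) (r M C) (r M (X ∪ C))))))
  where
  open _IsMinorOf_Via_ via

  D : Subset _
  D = (E M ─ C) ─ E N

  D⊆ : D ⊆ E M ─ C
  D⊆ = p─q⊆p (E M ─ C) (E N)

  EN⊆ : E N ⊆ (E M ─ C) ─ D
  EN⊆ x∈ = x∈p∧x∉q⇒x∈p─q (x∈p∧x∉q⇒x∈p─q (EN⊆EM x∈) (disjoint x∈))
    (λ x∈D → ∉-─ (E M ─ C) (E N) x∈D x∈)

  ⊆EN : (E M ─ C) ─ D ⊆ E N
  ⊆EN {x} x∈ = decidable-stable (x ∈? E N) λ x∉ →
    ∉-─ (E M ─ C) D x∈ (x∈p∧x∉q⇒x∈p─q (p─q⊆p (E M ─ C) D x∈) x∉)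

  lin : ∀ a b c → (a + b) - c ≡ a - (c - b)
  lin = solve-∀

module _ {M N : Polymatroid k n} {C : Subset n} (via : N IsMinorOf M Via C)
         {e : Fin n} (e∈E : e ∈ E M) (e∉N : e ∉ E N) where

  open _IsMinorOf_Via_ via

  private
    ∈⇒≢e : ∀ {p : Subset n} → e ∉ p → ∀ {x} → x ∈ p → x ∉ ⁅ e ⁆
    ∈⇒≢e e∉p x∈p x∈e = e∉p (subst (_∈ _) (x∈⁅y⁆⇒x≡y e x∈e) x∈p)

    EN⊆E─e : E N ⊆ E M ─ ⁅ e ⁆
    EN⊆E─e x∈ = x∈p∧x∉q⇒x∈p─q (EN⊆EM x∈) (∈⇒≢e e∉N x∈)

  minor-of-delete₁ : e ∉ C → N IsMinorOf delete₁ M e e∈E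
  minor-of-delete₁ e∉C = via⇒minor {C = C} record
    { EN⊆EM = EN⊆E─e
    ; C⊆E = λ x∈ → x∈p∧x∉q⇒x∈p─q (C⊆E x∈) (∈⇒≢e e∉C x∈)
    ; disjoint = disjoint
    ; rank = rank
    }

  -- Contract `e` first and the rest of `C` afterwards; the two copies of r(e) cancel in the rank
  -- equation.
  minor-of-contract₁ : e ∈ C → N IsMinorOf contract₁ M e e∈E
  minor-of-contract₁ e∈C = via⇒minor {C = C ─ ⁅ e ⁆} record
    { EN⊆EM = EN⊆E─e
    ; C⊆E = λ x∈ → x∈p∧x∉q⇒x∈p─q (C⊆E (p─q⊆p C ⁅ e ⁆ x∈)) (∉-─ C ⁅ e ⁆ x∈)
    ; disjoint = λ x∈ → disjoint x∈ ∘ p─q⊆p C ⁅ e ⁆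
    ; rank = λ {Z} Z⊆ → ≡-by
        (trans (trans (cong (λ D → r N Z + r M D) C─e∪e≡C) (rank Z⊆))
          (cong (r M) (trans (cong (Z ∪_) (sym C─e∪e≡C)) (sym (∪-assoc Z (C ─ ⁅ e ⁆) ⁅ e ⁆)))))
        (lin (r N Z) (r M ((C ─ ⁅ e ⁆) ∪ ⁅ e ⁆)) (r M ⁅ e ⁆) (r M ((Z ∪ (C ─ ⁅ e ⁆)) ∪ ⁅ e ⁆)))
    }
    where
    C─e∪e≡C : (C ─ ⁅ e ⁆) ∪ ⁅ e ⁆ ≡ C
    C─e∪e≡C = ⊆-antisym (∪-⊆ (p─q⊆p C ⁅ e ⁆) (⁅⁆-⊆ e∈C)) λ {x} → back x
      where
      back : ∀ x → x ∈ C → x ∈ (C ─ ⁅ e ⁆) ∪ ⁅ e ⁆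
      back x x∈ with x ∈? ⁅ e ⁆
      ... | yes x∈e = ∈-∪ʳ {p = C ─ ⁅ e ⁆} x∈e
      ... | no  x∉e = ∈-∪ˡ (x∈p∧x∉q⇒x∈p─q x∈ x∉e)

    lin : ∀ a b t c → (a + b) - c ≡ (a + (b - t)) - (c - t)
    lin = solve-∀

-- Rerouting a minor across a separation

-- For Z ⊆ X the marginal r(Z ∪ C) − r(C) depends only on C ∩ X and on T, so the
-- part of C on the other side may be exchanged for any V between T and Y ∪ T.
reroute : ∀ {M : Polymatroid k n} {T e X Y C} → Separation M T e X Y →
  T ⊆ C → C ⊆ (X ∪ Y) ∪ T → ∀ {V} → T ⊆ V → V ⊆ Y ∪ T → ∀ {Z} → Z ⊆ X →
  r M (Z ∪ C) + r M ((C ∩ X) ∪ V) ≡ r M (Z ∪ ((C ∩ X) ∪ V)) + r M C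
reroute {M = M} {T} {e} {X} {Y} {C} XY T⊆C C⊆ {V} T⊆V V⊆ {Z} Z⊆X =
  -- `old` at `Z` plus `new` at `⊥` has the same four rank terms on its left as `new` at `Z` plus
  -- `old` at `⊥`. Equating the right sides gives the claim.
  ≡-by (cong₂ _+_ (sym (cong₂ _+_ (old Z⊆X) (new (⊆-min X))))
                  (cong₂ _+_ (new Z⊆X) (old (⊆-min X))))
    (trans
      (lin (r M (U Z)) (r M (U ⊥)) (r M V₀) (r M V) (r M T)
        (r M (Z ∪ C)) (r M (⊥ ∪ (W ∪ V))) (r M (Z ∪ (W ∪ V))) (r M (⊥ ∪ C)))
      (cong₂ (λ A B → (r M (Z ∪ C) + r M A) - (r M (Z ∪ (W ∪ V)) + r M B))
        (∪-identityˡ (W ∪ V)) (∪-identityˡ C)))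
  where
  open Separation XY

  W V₀ : Subset _
  W = C ∩ X
  V₀ = (C ∩ Y) ∪ T

  U : Subset _ → Subset _
  U Z = (Z ∪ W) ∪ T

  U⊆ : ∀ {Z} → Z ⊆ X → U Z ⊆ X ∪ T
  U⊆ Z⊆ = ∪-⊆ (∈-∪ˡ ∘ ∪-⊆ Z⊆ (p∩q⊆q C X)) (∈-∪ʳ {p = X})

  old : ∀ {Z} → Z ⊆ X → r M (U Z) + r M V₀ ≡ r M (Z ∪ C) + r M T
  old {Z} Z⊆ = modular-≡ (∈-∪ʳ {p = Z ∪ W}) (U⊆ Z⊆) (∈-∪ʳ {p = C ∩ Y})
    (∪-⊆ (∈-∪ˡ ∘ p∩q⊆q C Y) (∈-∪ʳ {p = Y}))
    (⊆-antisym
      (∪-⊆ (∪-⊆ (∪-⊆ ∈-∪ˡ (∈-∪ʳ {p = Z} ∘ p∩q⊆p C X)) (∈-∪ʳ {p = Z} ∘ T⊆C))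
           (∪-⊆ (∈-∪ʳ {p = Z} ∘ p∩q⊆p C Y) (∈-∪ʳ {p = Z} ∘ T⊆C)))
      (∪-⊆ (∈-∪ˡ ∘ ∈-∪ˡ ∘ ∈-∪ˡ) C⊆U∪V₀))
    where
    C⊆U∪V₀ : C ⊆ U Z ∪ V₀
    C⊆U∪V₀ x∈C with x∈p∪q⁻ (X ∪ Y) T (C⊆ x∈C)
    ... | inj₂ x∈T = ∈-∪ˡ (∈-∪ʳ {p = Z ∪ W} x∈T)
    ... | inj₁ x∈  with x∈p∪q⁻ X Y x∈
    ... | inj₁ x∈X = ∈-∪ˡ (∈-∪ˡ (∈-∪ʳ {p = Z} (x∈p∩q⁺ (x∈C , x∈X))))
    ... | inj₂ x∈Y = ∈-∪ʳ {p = U Z} (∈-∪ˡ (x∈p∩q⁺ (x∈C , x∈Y)))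

  new : ∀ {Z} → Z ⊆ X → r M (U Z) + r M V ≡ r M (Z ∪ (W ∪ V)) + r M T
  new {Z} Z⊆ = modular-≡ (∈-∪ʳ {p = Z ∪ W}) (U⊆ Z⊆) T⊆V V⊆
    (⊆-antisym
      (∪-⊆ (∪-⊆ (∪-⊆ ∈-∪ˡ (∈-∪ʳ {p = Z} ∘ ∈-∪ˡ)) (V⊆′ ∘ T⊆V)) V⊆′)
      (∪-⊆ (∈-∪ˡ ∘ ∈-∪ˡ ∘ ∈-∪ˡ)
           (∪-⊆ (∈-∪ˡ ∘ ∈-∪ˡ ∘ ∈-∪ʳ {p = Z}) (∈-∪ʳ {p = U Z}))))
    where
    V⊆′ : V ⊆ Z ∪ (W ∪ V)
    V⊆′ = ∈-∪ʳ {p = Z} ∘ ∈-∪ʳ {p = W}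

  lin : ∀ u w v₀ v t a b c d →
    (((a + t) + (b + t)) + ((u + v) + (w + v₀))) - (((u + v₀) + (w + v)) + ((c + t) + (d + t)))
    ≡ (a + b) - (c + d)
  lin = solve-∀

-- With E(N) inside `X`, the rank function of `N` consists of marginals that `reroute` leaves
-- unchanged, so the new contracted set yields the same minor.
via-reroute : ∀ {M N : Polymatroid k n} {T e X Y C} → Separation M T e X Y →
  T ⊆ C → C ⊆ (X ∪ Y) ∪ T → E N ⊆ X → N IsMinorOf M Via C →
  ∀ {V} → T ⊆ V → V ⊆ Y ∪ T → N IsMinorOf M Via ((C ∩ X) ∪ V)
via-reroute {M = M} {N} {T} {e} {X} {Y} {C} XY T⊆C C⊆ N⊆X via {V} T⊆V V⊆ = record
  { EN⊆EM = EN⊆EM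
  ; C⊆E = ∪-⊆ (C⊆E ∘ p∩q⊆p C X) (Y∪T⊆E ∘ V⊆)
  ; disjoint = λ x∈N → [ N#C x∈N ∘ p∩q⊆p C X ,
      [ X#Y (N⊆X x∈N) , N#C x∈N ∘ T⊆C ]′ ∘ x∈p∪q⁻ Y T ∘ V⊆ ]′ ∘ x∈p∪q⁻ (C ∩ X) V
  ; rank = λ {Z} Z⊆ → ≡-by
      (cong₂ _+_ (rank Z⊆) (reroute XY T⊆C C⊆ T⊆V V⊆ (N⊆X ∘ Z⊆)))
      (lin (r N Z) (r M C) (r M (Z ∪ C)) (r M ((C ∩ X) ∪ V)) (r M (Z ∪ ((C ∩ X) ∪ V))))
  }
  where
  open Separation XY using (Y∪T⊆E) renaming (disjoint to X#Y)
  open _IsMinorOf_Via_ via renaming (disjoint to N#C)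

  lin : ∀ n c z c′ z′ → ((n + c) + (z + c′)) - (z + (z′ + c)) ≡ (n + c′) - z′
  lin = solve-∀

-- Position of a connected minor in a separation

separation-side : ∀ {M : Polymatroid k n} {T e X Y Z} → Separation M T e X Y →
  Z ⊆ E M → e ∉ Z → ¬ Nonempty (Z ∩ X) → Z ⊆ Y
separation-side XY Z⊆E e∉Z Z#X x∈ with Separation.cover XY (Z⊆E x∈)
... | inj₁ (inj₁ x∈X) = ⊥-elim (Z#X (_ , x∈p∩q⁺ (x∈ , x∈X)))
... | inj₁ (inj₂ x∈Y) = x∈Y
... | inj₂ refl = ⊥-elim (e∉Z x∈)

module _ {M N : Polymatroid k n} {C : Subset n} {e : Fin n} {X Y : Subset n} where

  contracted⊆X∪Y∪e : Separation M ⁅ e ⁆ e X Y → N IsMinorOf M Via C → C ⊆ (X ∪ Y) ∪ ⁅ e ⁆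
  contracted⊆X∪Y∪e XY via x∈ with Separation.cover XY (_IsMinorOf_Via_.C⊆E via x∈)
  ... | inj₁ x∈X∪Y = ∈-∪ˡ (x∈p∪q⁺ x∈X∪Y)
  ... | inj₂ refl  = ∈-∪ʳ {p = X ∪ Y} (x∈⁅x⁆ e)

  contracted⊆X∪Y : Separation M ⊥ e X Y → N IsMinorOf M Via C → e ∉ C → C ⊆ (X ∪ Y) ∪ ⊥
  contracted⊆X∪Y XY via e∉C x∈ with Separation.cover XY (_IsMinorOf_Via_.C⊆E via x∈)
  ... | inj₁ x∈X∪Y = ∈-∪ˡ (x∈p∪q⁺ x∈X∪Y)
  ... | inj₂ refl  = ⊥-elim (e∉C x∈)

-- If E(N) met both sides, its traces `A` and `B` on them would separate `N`: the separation of the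
-- larger polymatroid passes to the minor.
connected-minor-one-side : ∀ {M N : Polymatroid k n} {T e X Y C} → Connected N →
  N IsMinorOf M Via C → e ∉ E N → T ⊆ C → C ⊆ (X ∪ Y) ∪ T →
  Separation M T e X Y → ∃₂ λ X Y → Separation M T e X Y × E N ⊆ X
connected-minor-one-side {M = M} {N} {T} {e} {X} {Y} {C} connN via e∉N T⊆C C⊆ XY
  with nonempty? (E N ∩ X) | nonempty? (E N ∩ Y)
... | no ¬A | _ = _ , _ , swap XY , separation-side XY (_IsMinorOf_Via_.EN⊆EM via) e∉N ¬A
... | yes _ | no ¬B = _ , _ , XY , separation-side (swap XY) (_IsMinorOf_Via_.EN⊆EM via) e∉N ¬B
... | yes A≠∅ | yes B≠∅ = ⊥-elim
  (connected⇒inseparable N connN {A} {B} (p∩q⊆p (E N) X) (p∩q⊆p (E N) Y) E⊆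
    (λ x∈A x∈B → disjoint (p∩q⊆q (E N) X x∈A) (p∩q⊆q (E N) Y x∈B)) A≠∅ B≠∅ sep)
  where
  open Separation XY
  open _IsMinorOf_Via_ via hiding (disjoint)

  A B : Subset _
  A = E N ∩ X
  B = E N ∩ Y

  E⊆ : E N ⊆ A ∪ B
  E⊆ x∈ with cover (EN⊆EM x∈)
  ... | inj₁ (inj₁ x∈X) = ∈-∪ˡ (x∈p∩q⁺ (x∈ , x∈X))
  ... | inj₁ (inj₂ x∈Y) = ∈-∪ʳ {p = A} (x∈p∩q⁺ (x∈ , x∈Y))
  ... | inj₂ refl = ⊥-elim (e∉N x∈)


  C⊆′ : C ⊆ (Y ∪ X) ∪ T
  C⊆′ {x} x∈ = subst (λ S → x ∈ S ∪ T) (∪-comm X Y) (C⊆ x∈)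

  V W A′ B′ : Subset _
  V = (C ∩ X) ∪ T
  W = (C ∩ Y) ∪ T
  A′ = A ∪ V
  B′ = B ∪ W

  V⊆ : V ⊆ X ∪ T
  V⊆ = ∪-⊆ (∈-∪ˡ ∘ p∩q⊆q C X) (∈-∪ʳ {p = X})

  W⊆ : W ⊆ Y ∪ T
  W⊆ = ∪-⊆ (∈-∪ˡ ∘ p∩q⊆q C Y) (∈-∪ʳ {p = Y})

  C⊆V∪W : C ⊆ V ∪ W
  C⊆V∪W x∈C with x∈p∪q⁻ (X ∪ Y) T (C⊆ x∈C)
  ... | inj₂ x∈T = ∈-∪ˡ (∈-∪ʳ {p = C ∩ X} x∈T)
  ... | inj₁ x∈  with x∈p∪q⁻ X Y x∈
  ... | inj₁ x∈X = ∈-∪ˡ (∈-∪ˡ (x∈p∩q⁺ (x∈C , x∈X)))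
  ... | inj₂ x∈Y = ∈-∪ʳ {p = V} (∈-∪ˡ (x∈p∩q⁺ (x∈C , x∈Y)))

  spanned : r M A′ + r M B′ ≤ r M (E N ∪ C) + r M T
  spanned = begin
    r M A′ + r M B′
      ≤⟨ modular-≤ (∪-⊆ (∈-∪ˡ ∘ p∩q⊆q (E N) X) V⊆) (∪-⊆ (∈-∪ˡ ∘ p∩q⊆q (E N) Y) W⊆) ⟩
    r M (A′ ∪ B′) + r M T
      ≤⟨ +-monoˡ-≤ (r M T) (r-mono M
           (∪-⊆ (∪-⊆ (∈-∪ˡ ∘ p∩q⊆p (E N) X) (∈-∪ʳ {p = E N} ∘ ∪-⊆ (p∩q⊆p C X) T⊆C))
                (∪-⊆ (∈-∪ˡ ∘ p∩q⊆p (E N) Y) (∈-∪ʳ {p = E N} ∘ ∪-⊆ (p∩q⊆p C Y) T⊆C)))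
           (∪-⊆ EN⊆EM C⊆E)) ⟩
    r M (E N ∪ C) + r M T ∎
    where open ≤-Reasoning

  -- Rerouting with `T` alone on the far side gives r_N(A) = r(A′) - r(V) and r_N(B) = r(B′) - r(W).
  -- Now `spanned` bounds r(A′) + r(B′), and submodularity gives r(C) + r(T) ≤ r(V) + r(W).
  sep : r N A + r N B ≤ r N (E N)
  sep = ≤-by
    (+-mono-≤
      (≤-reflexive (cong₂ _+_
        (cong₂ _+_ (rank (p∩q⊆p (E N) X))
          (reroute XY T⊆C C⊆ id (∈-∪ʳ {p = Y}) (p∩q⊆q (E N) X)))
        (cong₂ _+_ (rank (p∩q⊆p (E N) Y))
          (reroute (swap XY) T⊆C C⊆′ id (∈-∪ʳ {p = X}) (p∩q⊆q (E N) Y)))))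
      (+-mono-≤ (≤-reflexive (sym (rank id)))
        (+-mono-≤ spanned
          (submodular M (X∪T⊆E ∘ V⊆) (Y∪T⊆E ∘ W⊆) C⊆V∪W
            (∈-∪ʳ {p = C ∩ X}) (∈-∪ʳ {p = C ∩ Y})))))
    (lin (r N A) (r N B) (r N (E N)) (r M C) (r M (A ∪ C)) (r M (B ∪ C)) (r M (E N ∪ C))
      (r M V) (r M W) (r M A′) (r M B′) (r M T))
    where
    lin : ∀ a b n c ac bc nc v w a′ b′ t →
      ((((a + c) + (ac + v)) + ((b + c) + (bc + w))) + (nc + ((a′ + b′) + (c + t))))
      - (((ac + (a′ + c)) + (bc + (b′ + c))) + ((n + c) + ((nc + t) + (v + w))))
      ≡ (a + b) - n
    lin = solve-∀

-- Descent on the side away from the minor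

module Descent {M N : Polymatroid k n} (connM : Connected M) where

  Removable : Set
  Removable = ∃ λ e → Σ (e ∈ E M) λ e∈E → e ∉ E N ×
    ((Connected (delete₁ M e e∈E) × N IsMinorOf delete₁ M e e∈E) ⊎
     (Connected (contract₁ M e e∈E) × N IsMinorOf contract₁ M e e∈E))

  module _ {T T′ e y X Y R S} (XY : Separation M T e X Y) (RS : Separation M T′ y R S)
           (X#R : ∀ {x} → x ∈ X → x ∉ R) where

    private
      module XY = Separation XY
      module RS = Separation RS

    -- Gives termination: `R` avoids both `X` and `e`, hence lies in `Y`, and it omits `y`.
    far-side-shrinks : y ∈ Y → e ∈ S → ∣ R ∣ < ∣ Y ∣
    far-side-shrinks y∈Y e∈S = p⊂q⇒∣p∣<∣q∣ (R⊆Y , _ , y∈Y , RS.e∉X)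
      where
      R⊆Y : R ⊆ Y
      R⊆Y x∈R with XY.cover (RS.X⊆E x∈R)
      ... | inj₁ (inj₁ x∈X) = ⊥-elim (X#R x∈X x∈R)
      ... | inj₁ (inj₂ x∈Y) = x∈Y
      ... | inj₂ refl = ⊥-elim (RS.disjoint x∈R e∈S)

    near-side-⊆ : y ∈ Y → X ⊆ S
    near-side-⊆ y∈Y x∈X with RS.cover (XY.X⊆E x∈X)
    ... | inj₁ (inj₁ x∈R) = ⊥-elim (X#R x∈X x∈R)
    ... | inj₁ (inj₂ x∈S) = x∈S
    ... | inj₂ refl = ⊥-elim (XY.disjoint x∈X y∈Y)

  mutual

    -- Any `y` in `Y` serves, as it lies outside E(N). In the recursive call `S` is the near side,
    -- which contains `X` and so E(N), and `R` is the far side.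
    descend-delete : ∀ {e X Y C} → Acc _<_ ∣ Y ∣ → Separation M ⊥ e X Y → E N ⊆ X →
      N IsMinorOf M Via C → e ∉ C → Removable
    descend-delete {e} {X} {Y} {C} (acc rec) XY N⊆X via e∉C =
      [ (λ conn → y , y∈E , y∉N , inj₂ (conn , minor-of-contract₁ via′ y∈E y∉N y∈C′))
      , continue ∘ towards e∈E (λ { refl → e∉Y y∈Y })
      ]′ (contract-connected⊎separation M y∈E)
      where
      open Separation XY

      y = proj₁ Y≠∅
      y∈Y = proj₂ Y≠∅

      y∈E : y ∈ E M
      y∈E = Y⊆E y∈Y

      y∉N : y ∉ E N
      y∉N y∈N = disjoint (N⊆X y∈N) y∈Y

      C⊆ : C ⊆ (X ∪ Y) ∪ ⊥
      C⊆ = contracted⊆X∪Y XY via e∉C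

      via′ : N IsMinorOf M Via ((C ∩ X) ∪ ⁅ y ⁆)
      -- The choice of `V` makes `y` the only contracted element of `Y`.
      via′ = via-reroute XY (⊆-min C) C⊆ N⊆X via (⊆-min _) (∈-∪ˡ ∘ ⁅⁆-⊆ y∈Y)

      y∈C′ : y ∈ (C ∩ X) ∪ ⁅ y ⁆
      y∈C′ = ∈-∪ʳ {p = C ∩ X} (x∈⁅x⁆ y)

      continue : (∃₂ λ R S → Separation M ⁅ y ⁆ y R S × e ∈ S) → Removable
      continue (R , S , RS , e∈S) =
        descend-contract (rec (far-side-shrinks XY RS X#R y∈Y e∈S)) (swap RS)
          (near-side-⊆ XY RS X#R y∈Y ∘ N⊆X) via′ y∈C′
        where
        X#R : ∀ {x} → x ∈ X → x ∉ R
        X#R = separations-cross connM XY RS y∈Y e∈S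

    descend-contract : ∀ {e X Y C} → Acc _<_ ∣ Y ∣ → Separation M ⁅ e ⁆ e X Y → E N ⊆ X →
      N IsMinorOf M Via C → e ∈ C → Removable
    descend-contract {e} {X} {Y} {C} (acc rec) XY N⊆X via e∈C =
      [ (λ conn → y , y∈E , y∉N , inj₁ (conn , minor-of-delete₁ via′ y∈E y∉N y∉C′))
      , continue ∘ towards e∈E (λ { refl → e∉Y y∈Y })
      ]′ (delete-connected⊎separation M y∈E)
      where
      open Separation XY

      y = proj₁ Y≠∅
      y∈Y = proj₂ Y≠∅

      y∈E : y ∈ E M
      y∈E = Y⊆E y∈Y

      y∉N : y ∉ E N
      y∉N y∈N = disjoint (N⊆X y∈N) y∈Y

      via′ : N IsMinorOf M Via ((C ∩ X) ∪ ⁅ e ⁆)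
      -- The least possible `V`, namely `T` itself: nothing of `Y` is contracted any more, so `y`
      -- can be deleted.
      via′ = via-reroute XY (⁅⁆-⊆ e∈C) (contracted⊆X∪Y∪e XY via) N⊆X via id (∈-∪ʳ {p = Y})

      y∉C′ : y ∉ (C ∩ X) ∪ ⁅ e ⁆
      y∉C′ = [ (λ y∈ → disjoint (p∩q⊆q C X y∈) y∈Y)
             , (λ y∈e → e∉Y (subst (_∈ Y) (x∈⁅y⁆⇒x≡y e y∈e) y∈Y)) ]′ ∘ x∈p∪q⁻ (C ∩ X) ⁅ e ⁆

      continue : (∃₂ λ P Q → Separation M ⊥ y P Q × e ∈ Q) → Removable
      continue (P , Q , PQ , e∈Q) =
        descend-delete (rec (far-side-shrinks XY PQ X#P y∈Y e∈Q)) (swap PQ)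
          (near-side-⊆ XY PQ X#P y∈Y ∘ N⊆X) via′ y∉C′
        where
        X#P : ∀ {x} → x ∈ X → x ∉ P
        -- The crossing lemma takes the deletion first, so the roles are exchanged: `y` is deleted
        -- and `e` contracted, with `P` in the place of `X` and `X` in that of `R`.
        X#P x∈X x∈P = separations-cross connM PQ XY e∈Q y∈Y x∈P x∈X

  -- Starts the descent by removing `e` in the way that `C` dictates. Connectedness of `N` puts E(N)
  -- on one side of the first separation; `near-side-⊆` keeps it there later.
  removable : ∀ {C e} → Connected N → N IsMinorOf M Via C → e ∈ E M → e ∉ E N → Removable
  removable {C} {e} connN via e∈E e∉N with e ∈? C
  ... | no e∉C =
    [ (λ conn → e , e∈E , e∉N , inj₁ (conn , minor-of-delete₁ via e∈E e∉N e∉C))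
    , (λ (_ , _ , XY) →
        let _ , _ , XY′ , N⊆X = connected-minor-one-side connN via e∉N (⊆-min C)
                                  (contracted⊆X∪Y XY via e∉C) XY
        in descend-delete (<-wellFounded _) XY′ N⊆X via e∉C)
    ]′ (delete-connected⊎separation M e∈E)
  ... | yes e∈C =
    [ (λ conn → e , e∈E , e∉N , inj₂ (conn , minor-of-contract₁ via e∈E e∉N e∈C))
    , (λ (_ , _ , XY) →
        let _ , _ , XY′ , N⊆X = connected-minor-one-side connN via e∉N (⁅⁆-⊆ e∈C)
                                  (contracted⊆X∪Y∪e XY via) XY
        in descend-contract (<-wellFounded _) XY′ N⊆X via e∈C)
    ]′ (contract-connected⊎separation M e∈E)

-- Proper minors and the theorem

-- Were the ground sets equal, `C` would be disjoint from all of E(M), hence empty, and the rank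
-- equation would identify `N` with `M`.
proper-minor-misses-element : ∀ {M N : Polymatroid k n} {C} → N IsMinorOf M Via C →
  ¬ (N ≈ M) → ∃ λ e → e ∈ E M × e ∉ E N
proper-minor-misses-element {M = M} {N} {C} via N≉M
  with any? (λ e → (e ∈? E M) ×-dec ¬? (e ∈? E N))
... | yes missing = missing
... | no ¬missing = ⊥-elim (N≉M (⊆-antisym EN⊆EM EM⊆EN , λ {X} X⊆ →
  trans (sym (+-identityʳ (r N X))) (trans (cong (r N X +_) (sym (r-⊥ M)))
    (subst (λ D → r N X + r M D ≡ r M X) C≡⊥
      (trans (rank X⊆) (cong (r M) (trans (cong (X ∪_) C≡⊥) (∪-identityʳ X))))))))
  where
  open _IsMinorOf_Via_ via

  EM⊆EN : E M ⊆ E N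
  EM⊆EN {x} x∈ = decidable-stable (x ∈? E N) λ x∉ → ¬missing (x , x∈ , x∉)

  C≡⊥ : C ≡ ⊥
  C≡⊥ = Empty-unique λ (x , x∈C) → disjoint (EM⊆EN (C⊆E x∈C)) x∈C

theorem1p1 : ∀ {n : ℕ} (M N : Polymatroid 2 n) →
    Connected M → Connected N → N IsMinorOf M → ¬ (N ≈ M) →
    ∃ λ (e : Fin n) → Σ (e ∈ E M) λ e∈E → e ∉ E N ×
    ((Connected (delete₁ M e e∈E) × N IsMinorOf delete₁ M e e∈E) ⊎
    (Connected (contract₁ M e e∈E) × N IsMinorOf contract₁ M e e∈E))
theorem1p1 M N connM connN N≤M N≉M =
  let _ , via = minor⇒via N≤M
      e , e∈E , e∉N = proper-minor-misses-element via N≉M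
  in Descent.removable connM connN via e∈E e∉N
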